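{- For any string $S$ over the binary alphabet $\Sigma_2 = \{\mathtt{0},\mathtt{1}\}$ with $|S| = d \ge 3$, $$|\mathsf{MAW}(S) \bigtriangleup \mathsf{MAW}(S\mathtt{0})| \le d,$$ and this upper bound is tight: for every $d \ge 3$ there is a string $S$ over $\Sigma_2$ with $|S| = d$ and $|\mathsf{MAW}(S) \bigtriangleup \mathsf{MAW}(S\mathtt{0})| = d$.
   Context: A string $w$ occurs in $S$ if it is a (contiguous) substring of $S$; the empty string occurs in every string. A non-empty string $w \in \Sigma_2^*$ is a minimal absent word (MAW) for $S$ if $w$ does not occur in $S$ but every proper substring of $w$ occurs in $S$ (in particular a character of $\Sigma_2$ not occurring in $S$ is a MAW for $S$). $\mathsf{MAW}(S)$ is the set of all MAWs for $S$ relative to the alphabet $\Sigma_2$. $\bigtriangleup$ denotes symmetric difference, and $S\mathtt{0}$ is $S$ with the character $\mathtt{0}$ appended on the right. -}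

module Defs where

open import Data.Digit using (Bit)
open import Data.List.Base using (List; []; length)
open import Data.List.Membership.Propositional using (_∈_)
open import Data.List.Relation.Binary.Infix.Heterogeneous using (Infix)
open import Data.List.Relation.Unary.Unique.Propositional using (Unique)
open import Data.Nat.Base using (ℕ)
open import Data.Product.Base using (_×_; ∃-syntax)
open import Function.Bundles using (_⇔_)
open import Level using (Level; _⊔_)
open import Relation.Binary.PropositionalEquality.Core using (_≡_; _≢_)
open import Relation.Nullary.Negation.Core using (¬_)
open import Relation.Unary using (Pred; _∪_; _∖_)

private
  variable
    a p q : Level

String₂ : Set
String₂ = List Bit

infix 4 _OccursIn_ _ProperSubstringOf_

_OccursIn_ : String₂ → String₂ → Set
w OccursIn S = Infix _≡_ w S

_ProperSubstringOf_ : String₂ → String₂ → Set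
u ProperSubstringOf w = u OccursIn w × u ≢ w

record MAW (S w : String₂) : Set where
  field
    nonEmpty : w ≢ []
    absent   : ¬ (w OccursIn S)
    minimal  : ∀ u → u ProperSubstringOf w → u OccursIn S

infixr 6 _△_

_△_ : {A : Set a} → Pred A p → Pred A q → Pred A (p ⊔ q)
P △ Q = (P ∖ Q) ∪ (Q ∖ P)

-- |P| = n, witnessed by a duplicate-free list of exactly the elements of P.
-- (Counting elements rather than inhabitants of the Σ-type of P: membership
-- in P need not be proof-irrelevant.)
HasCardinality : {A : Set a} → Pred A p → ℕ → Set (a ⊔ p)
HasCardinality {A = A} P n =
  ∃[ xs ] Unique xs × length xs ≡ n × (∀ (x : A) → x ∈ xs ⇔ P x)

{-# OPTIONS --safe #-}
module Submission where

-- Write S = v u, where x = u c is the shortest suffix of S c absent from S, and let ē be the letter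
-- other than e. Every word of MAW(S) △ MAW(S c) is x (the only word lost), one of x c and x c̄, or
-- ē p u c for a splitting v = p′ e p such that ē p u occurs in S. In the last case p′ is non-empty,
-- by length, which gives at most 3 + (|v| − 1) words and settles |u| ≥ 2. If u is empty, then c does
-- not occur in S and the last case is void. If |u| = 1, one more word must be discarded: x c if c c
-- does not occur in S c, and otherwise the splitting with |p′| = 1.
-- For S = 0 1^(d−1) and c = 0 the words 10, 101 and 0 1^j 0 with 1 ≤ j ≤ d − 2 attain the bound.

open import Defs
open import Data.Digit using (Bit; 0b; 1b)
open import Data.Fin.Base using (opposite; zero; suc)
import Data.Fin.Properties as Fin
open import Data.List.Base
  using (List; []; _∷_; [_]; _++_; _∷ʳ_; length; filter; deduplicate;
         map; replicate; upTo; initLast; _∷ʳ′_)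
open import Data.List.Membership.Propositional using (_∈_)
open import Data.List.Membership.Propositional.Properties
  using (∈-filter⁺; ∈-filter⁻; ∈-deduplicate⁺; ∈-deduplicate⁻; ∈-map⁻; ∈-upTo⁻)
open import Data.List.Properties
  using (length-filter; length-deduplicate; filter-notAll; length-++; length-map;
         length-upTo; length-replicate; ++-assoc; ∷ʳ-injectiveˡ;
         ∷-injective; ∷-injectiveʳ; ≡-dec; ∷ʳ-++)
open import Data.List.Relation.Binary.Infix.Heterogeneous
  using (Infix; here; there; _++ⁱ_; _ⁱ++_)
import Data.List.Relation.Binary.Infix.Heterogeneous.Properties as Infix
open import Data.List.Relation.Binary.Prefix.Heterogeneous
  using (Prefix; []; _∷_)
import Data.List.Relation.Binary.Prefix.Heterogeneous.Properties as Prefix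
import Data.List.Relation.Binary.Suffix.Heterogeneous.Properties as Suffix
import Data.List.Relation.Binary.Pointwise as Pointwise
import Data.List.Relation.Unary.All as All
open import Data.List.Relation.Unary.All using (All; []; _∷_)
open import Data.List.Relation.Unary.AllPairs using ([]; _∷_)
open import Data.List.Relation.Unary.Any as Any using (here; there)
open import Data.List.Relation.Unary.Unique.Propositional using (Unique)
open import Data.List.Relation.Unary.Unique.Propositional.Properties
  using (map⁺; upTo⁺)
open import Data.List.Relation.Unary.Unique.DecPropositional.Properties
  using (deduplicate-!)
open import Data.Nat.Base using (ℕ; zero; suc; _+_; _≤_; _<_; z≤n; s≤s)
open import Data.Nat.Properties
  using (≤-trans; ≤-refl; ≤-reflexive; ≤-antisym; <-irrefl; m≤m+n; m≤n+m; +-comm;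
         m≤n⇒m≤1+n; 1+n≰n; suc-injective)
open import Data.Product.Base using (_×_; _,_; proj₂; ∃-syntax)
open import Data.Sum.Base using (_⊎_; inj₁; inj₂)
open import Function.Base using (_∘_)
open import Function.Bundles using (Equivalence; mk⇔)
open import Relation.Binary.Definitions using (DecidableEquality)
open import Relation.Binary.PropositionalEquality.Core
  using (_≡_; _≢_; refl; sym; trans; cong; subst)
open import Relation.Nullary.Decidable using (Dec; yes; no; ¬?; _×-dec_; _⊎-dec_)
open import Relation.Nullary.Negation.Core using (¬_; contradiction)
open import Relation.Unary using (Pred; Decidable)

-- Counting by finite lists.

module _ {A : Set} (_≟_ : DecidableEquality A) where

  unique-⊆⇒length≤ : ∀ {xs ys : List A} → Unique xs → (∀ {z} → z ∈ xs → z ∈ ys) →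
                     length xs ≤ length ys
  unique-⊆⇒length≤ {[]} _ _ = z≤n
  unique-⊆⇒length≤ {x ∷ xs} {ys} (x∉xs ∷ uniq) xs⊆ys =
    ≤-trans (s≤s (unique-⊆⇒length≤ uniq sub))
            (filter-notAll ≢x? ys (Any.map (λ x≡y y≢x → y≢x (sym x≡y)) (xs⊆ys (here refl))))
    where
    ≢x? : Decidable (_≢ x)
    ≢x? y = ¬? (y ≟ x)

    sub : ∀ {z} → z ∈ xs → z ∈ filter ≢x? ys
    sub z∈xs = ∈-filter⁺ ≢x? (xs⊆ys (there z∈xs)) (All.lookup x∉xs z∈xs ∘ sym)

  -- Reduces the upper bound to finding a covering list, which may contain repetitions and elements
  -- outside `P`: filtering and deduplicating it leaves an exact enumeration.
  covered⇒cardinality : ∀ {p} {P : Pred A p} → Decidable P → (ys : List A) →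
                        (∀ x → P x → x ∈ ys) →
                        ∃[ n ] HasCardinality P n × n ≤ length ys
  covered⇒cardinality P? ys cover =
    length xs , (xs , deduplicate-! _≟_ (filter P? ys) , refl , λ x → mk⇔
      (λ x∈xs → proj₂ (∈-filter⁻ P? {xs = ys} (∈-deduplicate⁻ _≟_ (filter P? ys) x∈xs)))
      (λ Px → ∈-deduplicate⁺ _≟_ (∈-filter⁺ P? (cover x Px) Px))) ,
    ≤-trans (length-deduplicate _≟_ (filter P? ys)) (length-filter P? ys)
    where
    xs : List A
    xs = deduplicate _≟_ (filter P? ys)

  unique⇒length≤cardinality : ∀ {p n} {P : Pred A p} → HasCardinality P n → (xs : List A) →
                              Unique xs → (∀ {x} → x ∈ xs → P x) → length xs ≤ n
  unique⇒length≤cardinality (ys , _ , refl , ys⇔P) xs uniq xs⊆P =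
    unique-⊆⇒length≤ uniq (λ {x} x∈xs → Equivalence.from (ys⇔P x) (xs⊆P x∈xs))

-- Substrings and suffixes.

occurs-refl : ∀ {w} → w OccursIn w
occurs-refl = here (Prefix.fromPointwise (Pointwise.refl refl))

occurs-trans : ∀ {u v w} → u OccursIn v → v OccursIn w → u OccursIn w
occurs-trans = Infix.trans trans

[]-occurs : ∀ {w} → [] OccursIn w
[]-occurs = here []

tail-occurs : ∀ {a w S} → (a ∷ w) OccursIn S → w OccursIn S
tail-occurs = occurs-trans (there occurs-refl)

init-occurs : ∀ {w S} b → (w ∷ʳ b) OccursIn S → w OccursIn S
init-occurs b = occurs-trans (occurs-refl ⁱ++ [ b ])

prefix-∷ʳ⁻ : ∀ {w b : String₂} {c} → Prefix _≡_ w (b ∷ʳ c) → Prefix _≡_ w b ⊎ w ≡ b ∷ʳ c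
prefix-∷ʳ⁻ {b = []} [] = inj₁ []
prefix-∷ʳ⁻ {b = []} (refl ∷ []) = inj₂ refl
prefix-∷ʳ⁻ {b = _ ∷ _} [] = inj₁ []
prefix-∷ʳ⁻ {b = _ ∷ b} (refl ∷ p) with prefix-∷ʳ⁻ {b = b} p
... | inj₁ q = inj₁ (refl ∷ q)
... | inj₂ refl = inj₂ refl

occurs-∷ʳ⁻ : ∀ {w} S {c} → w OccursIn (S ∷ʳ c) →
             w OccursIn S ⊎ (∃[ v ] ∃[ u ] S ≡ v ++ u × w ≡ u ∷ʳ c)
occurs-∷ʳ⁻ [] (here p) with prefix-∷ʳ⁻ {b = []} p
... | inj₁ q = inj₁ (here q)
... | inj₂ eq = inj₂ ([] , [] , refl , eq)
occurs-∷ʳ⁻ [] (there (here [])) = inj₁ []-occurs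
occurs-∷ʳ⁻ (s ∷ S) (here p) with prefix-∷ʳ⁻ {b = s ∷ S} p
... | inj₁ q = inj₁ (here q)
... | inj₂ eq = inj₂ ([] , s ∷ S , refl , eq)
occurs-∷ʳ⁻ (s ∷ S) (there i) with occurs-∷ʳ⁻ S i
... | inj₁ j = inj₁ (there j)
... | inj₂ (v , u , eq , eq′) = inj₂ (s ∷ v , u , cong (s ∷_) eq , eq′)

-- In the second case the inclusion is strict and its first letter is exposed, which is the form
-- that `shortest` asks for.
suffixes-comparable : ∀ (v v′ : String₂) {u u′} → v ++ u ≡ v′ ++ u′ →
  (∃[ p ] u ≡ p ++ u′ × v′ ≡ v ++ p) ⊎ (∃[ a ] ∃[ p ] u′ ≡ a ∷ p ++ u)
suffixes-comparable [] v′ eq = inj₁ (v′ , eq , refl)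
suffixes-comparable (a ∷ v) [] eq = inj₂ (a , v , sym eq)
suffixes-comparable (a ∷ v) (b ∷ v′) eq
  with refl , eq′ ← ∷-injective eq | suffixes-comparable v v′ (∷-injectiveʳ eq)
... | inj₁ (p , eq₁ , eq₂) = inj₁ (p , eq₁ , cong (a ∷_) eq₂)
... | inj₂ r = inj₂ r

-- Minimal absent words and their decidability.

occurs? : ∀ w S → Dec (w OccursIn S)
occurs? = Infix.infix? Fin._≟_

_≟ₛ_ : DecidableEquality String₂
_≟ₛ_ = ≡-dec Fin._≟_

tail-of-MAW : ∀ {S a t} → MAW S (a ∷ t) → t OccursIn S
tail-of-MAW {S} {a} {t} m =
  MAW.minimal m t (there occurs-refl , λ eq → <-irrefl (cong length eq) ≤-refl)

init-of-MAW : ∀ {S} z {b} → MAW S (z ∷ʳ b) → z OccursIn S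
init-of-MAW z {b} m = MAW.minimal m z
  (occurs-refl ⁱ++ [ b ] ,
   λ eq → <-irrefl (trans (cong length eq) (trans (length-++ z) (+-comm _ 1))) ≤-refl)

-- A substring starting after the first letter lies in `t`; one starting at the first letter is a
-- prefix and, unless it is all of `w`, lies in `z`.
MAW-intro : ∀ {S w a t} z b → w ≡ a ∷ t → w ≡ z ∷ʳ b →
            ¬ (w OccursIn S) → t OccursIn S → z OccursIn S → MAW S w
MAW-intro {S} z b refl w≡zb absent t-occurs z-occurs = record
  { nonEmpty = λ ()
  ; absent   = absent
  ; minimal  = minimal
  }
  where
  minimal : ∀ u → u ProperSubstringOf _ → u OccursIn S
  minimal u (there i , _) = occurs-trans i t-occurs
  minimal u (here p , u≢w) with prefix-∷ʳ⁻ {b = z} (subst (Prefix _≡_ u) w≡zb p)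
  ... | inj₁ q = occurs-trans (here q) z-occurs
  ... | inj₂ u≡w = contradiction (trans u≡w (sym w≡zb)) u≢w

∷⇒∷ʳ : ∀ a (t : String₂) → ∃[ z ] ∃[ b ] a ∷ t ≡ z ∷ʳ b
∷⇒∷ʳ a [] = [] , a , refl
∷⇒∷ʳ a (c ∷ t) with z , b , eq ← ∷⇒∷ʳ c t = a ∷ z , b , cong (a ∷_) eq

∷ʳ⇒∷ : ∀ (z : String₂) b → ∃[ a ] ∃[ t ] z ∷ʳ b ≡ a ∷ t
∷ʳ⇒∷ [] b = b , [] , refl
∷ʳ⇒∷ (a ∷ z) b = a , z ∷ʳ b , refl

MAW? : ∀ S → Decidable (MAW S)
MAW? S [] = no λ m → MAW.nonEmpty m refl
MAW? S (a ∷ t) with z , b , eq ← ∷⇒∷ʳ a t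
  with occurs? (a ∷ t) S | occurs? t S | occurs? z S
... | yes w∈S | _       | _       = no λ m → MAW.absent m w∈S
... | no _    | no t∉S  | _       = no λ m → t∉S (tail-of-MAW m)
... | no _    | yes _   | no z∉S  = no λ m → z∉S (init-of-MAW z (subst (MAW S) eq m))
... | no w∉S  | yes t∈S | yes z∈S = yes (MAW-intro z b refl eq w∉S t∈S z∈S)

△? : ∀ {a p q} {A : Set a} {P : Pred A p} {Q : Pred A q} → Decidable P → Decidable Q →
     Decidable (P △ Q)
△? P? Q? w = (P? w ×-dec ¬? (Q? w)) ⊎-dec (Q? w ×-dec ¬? (P? w))

-- The shortest new suffix.

longer-absent : ∀ {w S : String₂} → length S < length w → ¬ (w OccursIn S)
longer-absent S<w w∈S = 1+n≰n (≤-trans S<w (Infix.length-mono w∈S))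

length-∷ʳ : ∀ (w : String₂) b → length (w ∷ʳ b) ≡ suc (length w)
length-∷ʳ w b = trans (length-++ w) (+-comm (length w) 1)

suffix-occurs : ∀ p {q} → q OccursIn (p ++ q)
suffix-occurs p = p ++ⁱ occurs-refl

suffix-∷ʳ-occurs : ∀ p {q} c → (q ∷ʳ c) OccursIn ((p ++ q) ∷ʳ c)
suffix-∷ʳ-occurs p {q} c = subst ((q ∷ʳ c) OccursIn_) (sym (++-assoc p q [ c ])) (suffix-occurs p)

-- u c is the shortest suffix of S c absent from S; it is enough to ask that its longest proper
-- suffix occurs in S.
record NewSuffix (S : String₂) (c : Bit) : Set where
  field
    v u      : String₂
    split    : S ≡ v ++ u
    absent   : ¬ ((u ∷ʳ c) OccursIn S)
    shortest : ∀ {a q} → u ≡ a ∷ q → (q ∷ʳ c) OccursIn S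

-- The search starts with S c, absent from S by length, and drops first letters until the next
-- shorter suffix occurs in S or only c is left.
newSuffix : ∀ S c → NewSuffix S c
newSuffix S c = search [] S refl (longer-absent (≤-reflexive (sym (length-∷ʳ S c))))
  where
  search : ∀ v u → S ≡ v ++ u → ¬ ((u ∷ʳ c) OccursIn S) → NewSuffix S c
  search v [] split absent =
    record { v = v ; u = [] ; split = split ; absent = absent ; shortest = λ () }
  search v (a ∷ q) split absent with occurs? (q ∷ʳ c) S
  ... | yes q∈S = record
    { v = v ; u = a ∷ q ; split = split ; absent = absent ; shortest = λ { refl → q∈S } }
  ... | no q∉S = search (v ∷ʳ a) q (trans split (sym (∷ʳ-++ v a q))) q∉S

opposite-≢ : ∀ (a : Bit) → opposite a ≢ a
opposite-≢ zero ()
opposite-≢ (suc zero) ()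

≢⇒opposite : ∀ {a b : Bit} → a ≢ b → a ≡ opposite b
≢⇒opposite {zero} {zero} a≢b = contradiction refl a≢b
≢⇒opposite {zero} {suc zero} a≢b = refl
≢⇒opposite {suc zero} {zero} a≢b = refl
≢⇒opposite {suc zero} {suc zero} a≢b = contradiction refl a≢b

-- Classification of the symmetric difference.

module Differences (S : String₂) (c : Bit) (new : NewSuffix S c) where
  open NewSuffix new

  -- Necessary conditions only: the family contains the symmetric difference and may be larger. The
  -- occurrence kept in `extended` serves the case |u| = 1, where it discards u c c if c c does not
  -- occur in S c.
  data Difference : String₂ → Set where
    lost     : Difference (u ∷ʳ c)
    extended : ∀ {a q} b → u ∷ʳ c ≡ a ∷ q → (q ∷ʳ b) OccursIn (S ∷ʳ c) →
               Difference (u ∷ʳ c ∷ʳ b)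
    flipped  : ∀ p₁ e p₂ → v ≡ p₁ ++ e ∷ p₂ → (opposite e ∷ p₂ ++ u) OccursIn S →
               Difference ((opposite e ∷ p₂ ++ u) ∷ʳ c)

  shorter-occurs : ∀ {a p q} → u ≡ a ∷ p ++ q → (q ∷ʳ c) OccursIn S
  shorter-occurs {p = p} eq = occurs-trans (suffix-∷ʳ-occurs p c) (shortest eq)

  longer-suffix : ∀ {v′ z} → S ≡ v′ ++ z → ¬ ((z ∷ʳ c) OccursIn S) →
                  ∃[ p ] z ≡ p ++ u × v ≡ v′ ++ p
  longer-suffix {v′} eq z∉S with suffixes-comparable v′ v (trans (sym eq) split)
  ... | inj₁ r = r
  ... | inj₂ (_ , _ , eq′) = contradiction (shorter-occurs eq′) z∉S

  -- A lost word occurs in S c, otherwise it would stay minimal absent. Hence it is a new suffix p u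
  -- c; a non-empty p would put u c inside its tail, which occurs in S.
  classify-lost : ∀ {w} → MAW S w → ¬ MAW (S ∷ʳ c) w → Difference w
  classify-lost {w} m ¬m′ with occurs? w (S ∷ʳ c)
  ... | no w∉Sc = contradiction
    (record { nonEmpty = MAW.nonEmpty m ; absent = w∉Sc
            ; minimal = λ y y<w → MAW.minimal m y y<w ⁱ++ [ c ] }) ¬m′
  ... | yes w∈Sc with occurs-∷ʳ⁻ S w∈Sc
  ... | inj₁ w∈S = contradiction w∈S (MAW.absent m)
  ... | inj₂ (v′ , z , eq , refl) with longer-suffix eq (MAW.absent m)
  ... | [] , refl , _ = lost
  ... | a ∷ p , refl , _ =
    contradiction (occurs-trans (suffix-∷ʳ-occurs p c) (tail-of-MAW m)) absent

  -- By minimality z is a new suffix p u c. For non-empty p the tail of the word contains u c b, and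
  -- its occurrence in S c puts u c in S.
  classify-extended : ∀ {a t} z b → a ∷ t ≡ z ∷ʳ b → MAW (S ∷ʳ c) (a ∷ t) →
                      ¬ (z OccursIn S) → Difference (a ∷ t)
  classify-extended z b eq m z∉S
    with occurs-∷ʳ⁻ S (init-of-MAW z (subst (MAW _) eq m))
  ... | inj₁ z∈S = contradiction z∈S z∉S
  ... | inj₂ (v′ , y , eq′ , refl) with longer-suffix eq′ z∉S
  ... | [] , refl , _ with ∷ʳ⇒∷ u c
  ... | a , q , eq″ = subst Difference (sym eq) (extended b eq″
        (tail-of-MAW (subst (MAW (S ∷ʳ c)) (trans eq (cong (_∷ʳ b) eq″)) m)))
  classify-extended z b eq m z∉S | inj₂ (v′ , y , eq′ , refl) | a ∷ p , refl , _ =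
    contradiction u∈S absent
    where
    ucb∈Sc : (u ∷ʳ c ∷ʳ b) OccursIn (S ∷ʳ c)
    ucb∈Sc = occurs-trans (suffix-∷ʳ-occurs p b)
      (tail-of-MAW (subst (MAW _) (trans eq (cong (λ y → a ∷ y ∷ʳ b) (++-assoc p u [ c ]))) m))

    -- Removing the last letter from an occurrence of u c b in S c leaves u c within S.
    u∈S : (u ∷ʳ c) OccursIn S
    u∈S with occurs-∷ʳ⁻ S ucb∈Sc
    ... | inj₁ ucb∈S = init-occurs b ucb∈S
    ... | inj₂ (v″ , s , eq″ , eq‴) rewrite sym (∷ʳ-injectiveˡ (u ∷ʳ c) s eq‴) =
      subst ((u ∷ʳ c) OccursIn_) (sym eq″) (suffix-occurs v″)

  -- Here t = y c is a new suffix and a y occurs in S. Some letter e precedes the suffix y of S,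
  -- since otherwise a y is longer than S; and e differs from a, since otherwise the word is a
  -- suffix of S c.
  classify-flipped : ∀ {a t} z b → a ∷ t ≡ z ∷ʳ b → MAW (S ∷ʳ c) (a ∷ t) →
                     z OccursIn S → ¬ (t OccursIn S) → Difference (a ∷ t)
  classify-flipped {a} z b eq m z∈S t∉S with occurs-∷ʳ⁻ S (tail-of-MAW m)
  ... | inj₁ t∈S = contradiction t∈S t∉S
  ... | inj₂ (v′ , y , eq′ , refl)
    with subst (_OccursIn S) (sym (∷ʳ-injectiveˡ (a ∷ y) z eq)) z∈S
       | longer-suffix eq′ t∉S | initLast v′
  ... | ay∈S | _ | [] =
    contradiction ay∈S (longer-absent (s≤s (≤-reflexive (cong length eq′))))
  ... | ay∈S | p , refl , v≡ | v″ ∷ʳ′ e with a Fin.≟ e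
  ... | yes refl = contradiction
    (subst ((a ∷ (p ++ u) ∷ʳ c) OccursIn_)
      (sym (trans (cong (_∷ʳ c) (trans eq′ (∷ʳ-++ v″ e (p ++ u))))
                  (++-assoc v″ (e ∷ p ++ u) [ c ])))
      (suffix-occurs v″))
    (MAW.absent m)
  ... | no a≢e with refl ← ≢⇒opposite a≢e =
    flipped v″ e p (trans v≡ (∷ʳ-++ v″ e p)) ay∈S

  classify-gained : ∀ {w} → MAW (S ∷ʳ c) w → ¬ MAW S w → Difference w
  classify-gained {[]} m ¬m′ = contradiction refl (MAW.nonEmpty m)
  classify-gained {a ∷ t} m ¬m′ with z , b , eq ← ∷⇒∷ʳ a t
    with occurs? z S | occurs? t S
  ... | no z∉S  | _       = classify-extended z b eq m z∉S
  ... | yes z∈S | no t∉S  = classify-flipped z b eq m z∈S t∉S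
  ... | yes z∈S | yes t∈S =
    contradiction (MAW-intro z b refl eq (λ w∈S → MAW.absent m (w∈S ⁱ++ [ c ])) t∈S z∈S) ¬m′

  classify : ∀ {w} → (MAW S △ MAW (S ∷ʳ c)) w → Difference w
  classify (inj₁ (m , ¬m′)) = classify-lost m ¬m′
  classify (inj₂ (m , ¬m′)) = classify-gained m ¬m′

-- Flipped words that cannot occur.

replicate-∷ʳ : ∀ {A : Set} n (a : A) → a ∷ replicate n a ≡ replicate n a ∷ʳ a
replicate-∷ʳ zero a = refl
replicate-∷ʳ (suc n) a = cong (a ∷_) (replicate-∷ʳ n a)

-- Each letter of t equals the one before it in a t, so the value a propagates.
prefix-shift⇒replicate : ∀ {a t} → Prefix {A = Bit} _≡_ t (a ∷ t) → t ≡ replicate (length t) a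
prefix-shift⇒replicate [] = refl
prefix-shift⇒replicate (refl ∷ p) = cong (_ ∷_) (prefix-shift⇒replicate p)

square-absent : ∀ {e c : Bit} n → e ≢ c → ¬ ((c ∷ c ∷ []) OccursIn (replicate n e ∷ʳ c))
square-absent zero _ (here (_ ∷ ()))
square-absent zero _ (there (here ()))
square-absent (suc n) e≢c (here (c≡e ∷ _)) = e≢c (sym c≡e)
square-absent (suc n) e≢c (there i) = square-absent n e≢c i

-- At the first position the leading letters differ, and later positions leave too little room. This
-- excludes the splitting of v with empty left part.
flip-absent₁ : ∀ {S e t} → S ≡ e ∷ t → ¬ ((opposite e ∷ t) OccursIn S)
flip-absent₁ {e = e} refl (here (eq ∷ _)) = opposite-≢ e eq
flip-absent₁ refl (there i) = longer-absent ≤-refl i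

-- Otherwise t is a prefix of e t, so S = ē e … e: for c = e the word t c is a suffix of S,
-- and for c = ē the square c c does not occur in S c = ē e … e ē.
flip-absent₂ : ∀ {S b c e t} → S ≡ b ∷ e ∷ t → ¬ ((t ∷ʳ c) OccursIn S) →
               (c ∷ c ∷ []) OccursIn (S ∷ʳ c) → ¬ ((opposite e ∷ t) OccursIn S)
flip-absent₂ refl _ _ (there i) = flip-absent₁ refl i
flip-absent₂ {c = c} {e} {t} refl tc∉S cc∈Sc (here (refl ∷ p)) with e Fin.≟ c
... | yes refl = tc∉S (subst (_OccursIn (opposite e ∷ e ∷ t)) e∷t≡t∷ʳe (there occurs-refl))
  where
  e∷t≡t∷ʳe : e ∷ t ≡ t ∷ʳ e
  e∷t≡t∷ʳe = subst (λ y → e ∷ y ≡ y ∷ʳ e) (sym (prefix-shift⇒replicate p))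
                   (replicate-∷ʳ (length t) e)
... | no e≢c with cc∈Sc
... | here (_ ∷ c≡e ∷ _) = e≢c (sym c≡e)
... | there i = square-absent (suc (length t)) e≢c
  (subst (λ y → (c ∷ c ∷ []) OccursIn (e ∷ y ∷ʳ c)) (prefix-shift⇒replicate p) i)

-- The upper bound.

flips : String₂ → String₂ → Bit → List String₂
flips []      u c = []
flips (e ∷ p) u c = (opposite e ∷ p ++ u) ∷ʳ c ∷ flips p u c

length-flips : ∀ p u c → length (flips p u c) ≡ length p
length-flips [] u c = refl
length-flips (e ∷ p) u c = cong suc (length-flips p u c)

∈-flips : ∀ p₁ {p e p₂ u c} → p ≡ p₁ ++ e ∷ p₂ → (opposite e ∷ p₂ ++ u) ∷ʳ c ∈ flips p u c
∈-flips [] refl = here refl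
∈-flips (_ ∷ p₁) refl = there (∈-flips p₁ refl)

module _ (c : Bit) where
  open Differences using (Difference; lost; extended; flipped)

  Covering : ∀ {S} → NewSuffix S c → Set
  Covering {S} new =
    ∃[ ws ] length ws ≤ length S × (∀ {w} → Difference S c new w → w ∈ ws)

  long : String₂ → List String₂
  long u = u ∷ʳ c ∷ u ∷ʳ c ∷ʳ c ∷ u ∷ʳ c ∷ʳ opposite c ∷ []

  extended∈long : ∀ u b ws → u ∷ʳ c ∷ʳ b ∈ long u ++ ws
  extended∈long u b ws with b Fin.≟ c
  ... | yes refl = there (here refl)
  ... | no b≢c with refl ← ≢⇒opposite b≢c = there (there (here refl))

  covering : ∀ S (new : NewSuffix S c) → 3 ≤ length S → Covering new
  covering S new@record { v = v ; u = [] ; split = split ; absent = absent } 3≤S =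
    long [] , 3≤S , cover
    where
    cover : ∀ {w} → Difference S c new w → w ∈ long []
    cover lost = here refl
    cover (extended b _ _) = extended∈long [] b []
    -- One of e and ē is c. The letter e lies in v and ē heads a word occurring in S, so either way
    -- c occurs in S.
    cover (flipped p₁ e p₂ v≡ i) with c Fin.≟ e
    ... | yes refl = contradiction
      (subst ([ c ] OccursIn_) (sym (trans split (cong (_++ []) v≡)))
        ((p₁ ++ⁱ here (refl ∷ [])) ⁱ++ []))
      absent
    ... | no c≢e with refl ← ≢⇒opposite c≢e =
      contradiction (occurs-trans (here (refl ∷ [])) i) absent
  covering S new@record { v = [] ; u = u@(_ ∷ _) ; split = split } 3≤S =
    long u , 3≤S , cover
    where
    cover : ∀ {w} → Difference S c new w → w ∈ long u
    cover lost = here refl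
    cover (extended b _ _) = extended∈long u b []
    cover (flipped [] _ _ () _)
    cover (flipped (_ ∷ _) _ _ () _)
  covering S new@record { v = a ∷ v ; u = u@(_ ∷ _ ∷ y) ; split = refl } 3≤S =
    long u ++ flips v u c , bound , cover
    where
    -- With `v` now lacking its first letter, the list has 3 + |v| words, while |S| = 3 + |v| + |y|.
    bound : length (long u ++ flips v u c) ≤ length S
    bound rewrite length-flips v u c | length-++ v {u} | +-comm (length v) (length u) =
      s≤s (s≤s (s≤s (m≤n+m (length v) (length y))))

    cover : ∀ {w} → Difference S c new w → w ∈ long u ++ flips v u c
    cover lost = here refl
    cover (extended b _ _) = extended∈long u b _
    cover (flipped [] _ _ v≡ i) = contradiction i (flip-absent₁ (cong (_++ u) v≡))
    cover (flipped (_ ∷ p₁) _ _ v≡ _) = there (there (there (∈-flips p₁ (∷-injectiveʳ v≡))))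
  covering S new@record { v = a ∷ [] ; u = _ ∷ [] ; split = refl } (s≤s (s≤s ()))
  covering S new@record { v = a ∷ a′ ∷ v ; u = u@(_ ∷ []) ; split = refl ; absent = absent } 3≤S
    with occurs? (c ∷ c ∷ []) (S ∷ʳ c)
  -- The word u c c can be left out, since its tail c c would have to occur in S c.
  ... | no cc∉Sc = (u ∷ʳ c ∷ u ∷ʳ c ∷ʳ opposite c ∷ flips (a′ ∷ v) u c) , bound , cover
    where
    bound : 2 + length (flips (a′ ∷ v) u c) ≤ length S
    bound rewrite length-flips v u c | length-++ v {u} | +-comm (length v) 1 = ≤-refl

    cover : ∀ {w} → Difference S c new w →
            w ∈ u ∷ʳ c ∷ u ∷ʳ c ∷ʳ opposite c ∷ flips (a′ ∷ v) u c
    cover lost = here refl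
    cover (extended b refl cb∈Sc) with b Fin.≟ c
    ... | yes refl = contradiction cb∈Sc cc∉Sc
    ... | no b≢c with refl ← ≢⇒opposite b≢c = there (here refl)
    cover (flipped [] _ _ v≡ i) = contradiction i (flip-absent₁ (cong (_++ u) v≡))
    cover (flipped (_ ∷ p₁) _ _ v≡ _) = there (there (∈-flips p₁ (∷-injectiveʳ v≡)))
  ... | yes cc∈Sc = (long u ++ flips v u c) , bound , cover
    where
    bound : 3 + length (flips v u c) ≤ length S
    bound rewrite length-flips v u c | length-++ v {u} | +-comm (length v) 1 = ≤-refl

    cover : ∀ {w} → Difference S c new w → w ∈ long u ++ flips v u c
    cover lost = here refl
    cover (extended b _ _) = extended∈long u b _
    cover (flipped [] _ _ v≡ i) = contradiction i (flip-absent₁ (cong (_++ u) v≡))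
    -- With t = p₂ u, an occurrence of t c in S would contain one of u c.
    cover (flipped (_ ∷ []) _ p₂ v≡ i) = contradiction i (flip-absent₂ (cong (_++ u) v≡)
      (λ tc∈S → absent (occurs-trans (suffix-∷ʳ-occurs p₂ c) tc∈S)) cc∈Sc)
    cover (flipped (_ ∷ _ ∷ p₁) _ _ v≡ _) =
      there (there (there (∈-flips p₁ (∷-injectiveʳ (∷-injectiveʳ v≡)))))

△-bound : ∀ S c → 3 ≤ length S →
          ∃[ n ] HasCardinality (MAW S △ MAW (S ∷ʳ c)) n × n ≤ length S
△-bound S c 3≤S with covering c S (newSuffix S c) 3≤S
... | ws , bound , cover
  with covered⇒cardinality _≟ₛ_ (△? (MAW? S) (MAW? (S ∷ʳ c))) ws
         (λ w → cover ∘ Differences.classify S c (newSuffix S c))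
... | n , card , n≤ = n , card , ≤-trans n≤ bound

-- Strings attaining the bound.

run : ℕ → String₂
run m = 0b ∷ replicate m 1b

[0]-absent-1ᵐ : ∀ m → ¬ ([ 0b ] OccursIn replicate m 1b)
[0]-absent-1ᵐ m i with () ← Infix.replicate⁻ {m = 1} {n = m} (λ ()) i

01-absent-1ᵐ0 : ∀ m {t} → ¬ ((0b ∷ 1b ∷ t) OccursIn (replicate m 1b ∷ʳ 0b))
01-absent-1ᵐ0 zero (here (_ ∷ ()))
01-absent-1ᵐ0 zero (there (here ()))
01-absent-1ᵐ0 (suc m) (here (() ∷ _))
01-absent-1ᵐ0 (suc m) (there i) = 01-absent-1ᵐ0 m i

-- With fewer ones, the final 0 of the prefix would face a 1.
1ʲ0-prefix⇒≥ : ∀ j m → Prefix _≡_ (replicate j 1b ∷ʳ 0b) (replicate m 1b ∷ʳ 0b) → m ≤ j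
1ʲ0-prefix⇒≥ j zero _ = z≤n
1ʲ0-prefix⇒≥ zero (suc m) (() ∷ _)
1ʲ0-prefix⇒≥ (suc j) (suc m) (_ ∷ p) = s≤s (1ʲ0-prefix⇒≥ j m p)

1ʲ0-absent : ∀ j m → ¬ ((replicate (suc j) 1b ∷ʳ 0b) OccursIn run m)
1ʲ0-absent j m (here (() ∷ _))
1ʲ0-absent j m (there i) = [0]-absent-1ᵐ m (occurs-trans (suffix-occurs (replicate (suc j) 1b)) i)

-- The exponent is shifted by one, so that indices below d - 2 give exponents from 1 to d - 2.
01ʲ0 : ℕ → String₂
01ʲ0 j = 0b ∷ replicate (suc j) 1b ∷ʳ 0b

module _ (n : ℕ) where

  private
    m = 2 + n
    S = run m

  10-lost : MAW S (1b ∷ 0b ∷ [])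
  10-lost = MAW-intro [ 1b ] 0b refl refl (1ʲ0-absent 0 m)
    (here (refl ∷ [])) (there (here (refl ∷ [])))

  1ʲ0-occurs : ∀ j → j ≤ m → (replicate j 1b ∷ʳ 0b) OccursIn (S ∷ʳ 0b)
  1ʲ0-occurs j j≤m = there (Infix.fromSuffix
    (Suffix.++⁺ (Suffix.replicate⁺ j≤m refl) (Pointwise.refl refl)))

  101-gained : MAW (S ∷ʳ 0b) (1b ∷ 0b ∷ 1b ∷ [])
  101-gained = MAW-intro (1b ∷ 0b ∷ []) 1b refl refl absent
    (here (refl ∷ refl ∷ [])) (1ʲ0-occurs 1 (s≤s z≤n))
    where
    absent : ¬ ((1b ∷ 0b ∷ 1b ∷ []) OccursIn (S ∷ʳ 0b))
    absent (here (() ∷ _))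
    absent (there i) = 01-absent-1ᵐ0 m (tail-occurs i)

  01ʲ0-gained : ∀ {j} → j < suc n → MAW (S ∷ʳ 0b) (01ʲ0 j)
  01ʲ0-gained {j} j<n = MAW-intro (run (suc j)) 0b refl refl absent
    (1ʲ0-occurs (suc j) (m≤n⇒m≤1+n j<n))
    (here (refl ∷ Prefix.replicate⁺ (m≤n⇒m≤1+n j<n) refl) ⁱ++ [ 0b ])
    where
    absent : ¬ (01ʲ0 j OccursIn (S ∷ʳ 0b))
    -- A match at the first letter forces m ≤ j + 1, but j + 1 ≤ n + 1 < m.
    absent (here (_ ∷ p)) = <-irrefl refl (≤-trans (s≤s j<n) (1ʲ0-prefix⇒≥ (suc j) m p))
    absent (there i) = 01-absent-1ᵐ0 m i

  witnesses : List String₂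
  witnesses = (1b ∷ 0b ∷ []) ∷ (1b ∷ 0b ∷ 1b ∷ []) ∷ map 01ʲ0 (upTo (suc n))

  witnesses-length : length witnesses ≡ 3 + n
  witnesses-length = cong (2 +_) (trans (length-map 01ʲ0 (upTo (suc n))) (length-upTo (suc n)))

  01ʲ0-injective : ∀ {i j} → 01ʲ0 i ≡ 01ʲ0 j → i ≡ j
  01ʲ0-injective {i} {j} eq = suc-injective (trans (sym (length-replicate (suc i)))
    (trans (cong length (∷-injectiveʳ (∷ʳ-injectiveˡ (run (suc i)) (run (suc j)) eq)))
           (length-replicate (suc j))))

  -- The first two words begin with 1 and all others with 0; the latter are told apart by their
  -- lengths.
  witnesses-unique : Unique witnesses
  witnesses-unique =
    ((λ ()) ∷ All.tabulate starts-with-0) ∷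
    All.tabulate starts-with-0 ∷
    map⁺ 01ʲ0-injective (upTo⁺ (suc n))
    where
    starts-with-0 : ∀ {t w} → w ∈ map 01ʲ0 (upTo (suc n)) → 1b ∷ t ≢ w
    starts-with-0 w∈
      with _ , _ , refl ← ∈-map⁻ 01ʲ0 {xs = upTo (suc n)} w∈ = λ ()

  witnesses⊆△ : ∀ {w} → w ∈ witnesses → (MAW S △ MAW (S ∷ʳ 0b)) w
  witnesses⊆△ (here refl) =
    inj₁ (10-lost , λ mw → MAW.absent mw (1ʲ0-occurs 1 (s≤s z≤n)))
  witnesses⊆△ (there (here refl)) =
    inj₂ (101-gained , λ mw → 1ʲ0-absent 0 m (init-of-MAW (1b ∷ 0b ∷ []) mw))
  witnesses⊆△ (there (there w∈))
    with j , j∈ , refl ← ∈-map⁻ 01ʲ0 {xs = upTo (suc n)} w∈ =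
    inj₂ (01ʲ0-gained (∈-upTo⁻ {suc n} j∈) , λ mw → 1ʲ0-absent j m (tail-of-MAW mw))

  run-length : length S ≡ 3 + n
  run-length = cong suc (length-replicate m)

  -- The cardinality k provided by the upper bound is at most |S| and at least the number of
  -- witnesses, so the witnesses need not be shown to be exhaustive.
  △-tight : HasCardinality (MAW S △ MAW (S ∷ʳ 0b)) (3 + n)
  △-tight with k , card , k≤S ← △-bound S 0b (subst (3 ≤_) (sym run-length) (m≤m+n 3 n)) =
    subst (HasCardinality _)
      (≤-antisym (≤-trans k≤S (≤-reflexive run-length))
        (subst (_≤ k) witnesses-length
          (unique⇒length≤cardinality _≟ₛ_ card witnesses witnesses-unique witnesses⊆△)))
      card

theorem4 : (d : ℕ) → 3 ≤ d →
    ((S : String₂) → length S ≡ d →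
    ∃[ n ] HasCardinality (MAW S △ MAW (S ∷ʳ 0b)) n × n ≤ d)
    × (∃[ S ] length S ≡ d × HasCardinality (MAW S △ MAW (S ∷ʳ 0b)) d)
theorem4 (suc (suc (suc n))) 3≤d@(s≤s (s≤s (s≤s _))) =
  (λ S eq → subst (λ d → ∃[ k ] HasCardinality (MAW S △ MAW (S ∷ʳ 0b)) k × k ≤ d) eq
    (△-bound S 0b (subst (3 ≤_) (sym eq) 3≤d))) ,
  run (2 + n) , run-length n , △-tight n
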